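{- For any $\epsilon\in(0,0.9)$, any one-pass $(1+\epsilon,0.49)$-$L_{\mathrm{DI}}$-sampler (in the node-arrival streaming model) on a data stream of length $n$ needs $\Omega(n)$ bits of space.
   Context: Similarity graph. $U$ is a universe of items and $f:U\times U\to[0,1]$ is a symmetric similarity function with $f(x,x)=1$ for all $x\in U$. For a stream $\sigma=(\sigma_1,\dots,\sigma_n)\in U^n$, the degree of node $i\in[n]$ in the similarity graph $G^\sigma$ (complete graph on $[n]$ with self-loops, weights $w(i,j)=f(\sigma_i,\sigma_j)$) is $d_i=\sum_{j\in[n]} f(\sigma_i,\sigma_j)$, and $\mathrm{DI}(\sigma)=\sum_{i\in[n]} d_i^{ -1}$. Each stream position is a distinct node; node $i$ is represented by the pair $(i,\sigma_i)$. Sampler. A $(1+\epsilon,\delta)$-$L_{\mathrm{DI}}$-sampler on $G^\sigma$ fails with probability at most $\delta$ and, conditioned on no failure, outputs node $i$ with a probability $p_i$ satisfying $(1-\epsilon)\frac{d_i^{ -1}}{\mathrm{DI}(\sigma)}\le p_i\le(1+\epsilon)\frac{d_i^{ -1}}{\mathrm{DI}(\sigma)}$, for every $i\in[n]$. Node-arrival streaming model. The items $\sigma_1,\dots,\sigma_n$ arrive sequentially and the algorithm, which has access to $f$, makes one or more linear scans (passes) over them while maintaining a bounded memory state. Algorithms are randomized; the algorithm's guarantee is required for every universe $U$, every similarity function $f$ and every stream $\sigma$ of length $n$, and its space is the worst-case number of bits of memory. -}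

module Defs where

open import Algebra.Bundles using (CommutativeRing)
open import Data.Bool.Base using (Bool; if_then_else_)
open import Data.Fin.Base using (Fin)
import Data.Fin.Properties as Fin
open import Data.Maybe.Base using (Maybe; just; nothing)
import Data.Maybe.Properties as Maybe
open import Data.Nat.Base using (ℕ)
open import Data.Product.Base using (∃-syntax; _×_; _,_)
import Data.Product.Properties as Product
open import Data.Sum.Base using (_⊎_)
open import Data.Vec.Base using (Vec)
open import Data.Vec.Functional using (Vector; foldl)
open import Level using (Level; suc; _⊔_)
open import Relation.Binary.Core using (Rel)
open import Relation.Binary.Definitions using (DecidableEquality)
import Relation.Binary.Construct.NonStrictToStrict as ToStrict
open import Relation.Binary.PropositionalEquality.Core using (_≡_)
open import Relation.Binary.Structures using (IsTotalOrder)
open import Relation.Nullary.Decidable.Core using (does; ¬?; _⊎-dec_)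
open import Relation.Unary using (Pred; Decidable)

-- The scalars (similarities, probabilities, ε) live in an arbitrary ordered
-- field, of which ℝ is the intended instance.  As usual for total inverses,
-- 0# ⁻¹ is unspecified.
record OrderedField c ℓ₁ ℓ₂ : Set (suc (c ⊔ ℓ₁ ⊔ ℓ₂)) where
  infix 8 _⁻¹
  infix 4 _≤_ _<_

  field
    commutativeRing : CommutativeRing c ℓ₁

  open CommutativeRing commutativeRing public

  field
    0≉1          : 0# ≉ 1#
    _⁻¹          : Carrier → Carrier
    ⁻¹-cong      : ∀ {x y} → x ≈ y → x ⁻¹ ≈ y ⁻¹
    *-inverseʳ   : ∀ {x} → x ≉ 0# → x * x ⁻¹ ≈ 1#
    _≤_          : Rel Carrier ℓ₂
    isTotalOrder : IsTotalOrder _≈_ _≤_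
    +-monoʳ-≤    : ∀ x {y z} → y ≤ z → x + y ≤ x + z
    *-nonNeg     : ∀ {x y} → 0# ≤ x → 0# ≤ y → 0# ≤ x * y

  _<_ : Rel Carrier (ℓ₁ ⊔ ℓ₂)
  _<_ = ToStrict._<_ _≈_ _≤_

  open import Algebra.Properties.CommutativeMonoid.Sum +-commutativeMonoid public
    using (sum)
  open import Algebra.Properties.Monoid.Mult +-monoid public
    using () renaming (_×_ to _·_)

  infixl 7 _÷_
  _÷_ : Carrier → Carrier → Carrier
  x ÷ y = x * y ⁻¹

  frac : ℕ → ℕ → Carrier
  frac a b = (a · 1#) ÷ (b · 1#)

-- A node of the similarity graph is represented by its position and its item.
Node : Set → ℕ → Set
Node U n = Fin n × U

module Streaming {c ℓ₁ ℓ₂} (F : OrderedField c ℓ₁ ℓ₂) where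
  open OrderedField F

  record Similarity (U : Set) : Set (c ⊔ ℓ₁ ⊔ ℓ₂) where
    field
      f      : U → U → Carrier
      f-≥0   : ∀ x y → 0# ≤ f x y
      f-≤1   : ∀ x y → f x y ≤ 1#
      f-sym  : ∀ x y → f x y ≈ f y x
      f-refl : ∀ x → f x x ≈ 1#

  module SimilarityGraph {U : Set} (sim : Similarity U) {n : ℕ} (σ : Vector U n) where
    open Similarity sim

    degree : Fin n → Carrier
    degree i = sum λ j → f (σ i) (σ j)

    DI : Carrier
    DI = sum λ i → degree i ⁻¹

  -- A randomized one-pass algorithm with b bits of memory: a random seed is
  -- drawn, and given the seed the algorithm is deterministic.  Reading the
  -- seed and the current position is not charged to the memory.
  -- The output `nothing` means failure.
  record OnePass (U : Set) (n b : ℕ) : Set (c ⊔ ℓ₁ ⊔ ℓ₂) where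
    field
      seeds      : ℕ
      weight     : Vector Carrier seeds
      weight-≥0  : ∀ ω → 0# ≤ weight ω
      weight-sum : sum weight ≈ 1#
      start      : Fin seeds → Vec Bool b
      step       : Fin seeds → Node U n → Vec Bool b → Vec Bool b
      output     : Fin seeds → Vec Bool b → Maybe (Node U n)

    run : Vector U n → Fin seeds → Maybe (Node U n)
    run σ ω = output ω (foldl (λ m v → step ω v m) (start ω) (λ i → i , σ i))

    Pr : ∀ {ℓ} {P : Pred (Fin seeds) ℓ} → Decidable P → Carrier
    Pr P? = sum λ ω → if does (P? ω) then weight ω else 0#

  module Sampling {u n b : ℕ} (sim : Similarity (Fin u)) (M : OnePass (Fin u) n b)
                  (σ : Vector (Fin u) n) where
    open OnePass M
    open SimilarityGraph sim σ

    _≟_ : DecidableEquality (Maybe (Node (Fin u) n))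
    _≟_ = Maybe.≡-dec (Product.≡-dec Fin._≟_ Fin._≟_)

    fails? : Decidable (λ ω → run σ ω ≡ nothing)
    fails? ω = run σ ω ≟ nothing

    outputs? : ∀ i → Decidable (λ ω → run σ ω ≡ just (i , σ i))
    outputs? i ω = run σ ω ≟ just (i , σ i)

    outputsNode? : Decidable (λ ω → ∃[ i ] run σ ω ≡ just (i , σ i))
    outputsNode? ω = Fin.any? λ i → outputs? i ω

    p : Fin n → Carrier
    p i = Pr (outputs? i) ÷ Pr (λ ω → ¬? (fails? ω))

    record IsSample (ε δ : Carrier) : Set (ℓ₁ ⊔ ℓ₂) where
      field
        failure : Pr fails? ≤ δ
        -- almost surely, whatever is output is a node of the graph
        node    : Pr (λ ω → fails? ω ⊎-dec outputsNode? ω) ≈ 1#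
        lower   : ∀ i → (1# - ε) * (degree i ⁻¹ ÷ DI) ≤ p i
        upper   : ∀ i → p i ≤ (1# + ε) * (degree i ⁻¹ ÷ DI)

  -- An algorithm for streams of length n must handle every (finite) universe and
  -- every similarity function, to which it has free access.  Its worst-case
  -- number of bits of memory is recorded as a function s of the size of the
  -- universe: since the algorithm outputs items, no single bound can hold for
  -- all universes at once.
  OnePassAlgorithm : ℕ → (ℕ → ℕ) → Set (c ⊔ ℓ₁ ⊔ ℓ₂)
  OnePassAlgorithm n s = ∀ u → Similarity (Fin u) → OnePass (Fin u) n (s u)

  IsLDISampler : ∀ {n s} → Carrier → Carrier → OnePassAlgorithm n s → Set (c ⊔ ℓ₁ ⊔ ℓ₂)
  IsLDISampler {n} ε δ A =
    ∀ u (sim : Similarity (Fin u)) (σ : Vector (Fin u) n) →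
    Sampling.IsSample sim (A u sim) σ ε δ

module Submission where

-- Reduction from INDEX.  The stream starts with m = ⌊n/3⌋ items (k , xₖ) encoding a
-- bit string x; they are mutually dissimilar for distinct k.  The remaining l = n − m
-- items are copies of one item similar to all (k , _) with k ≠ j and dissimilar
-- to (j , _).  Then node j has degree 1 and every other node has degree at least l ≥ n/2,
-- so DI ≤ 3 and the sampler outputs node j, hence reveals xⱼ, with probability bounded
-- below by a constant.  So the memory after m items answers, on average over x, a constant
-- fraction of the m bits, and (up to null seeds) never wrongly; with b bits of memory
-- the average number of answers is at most b for every seed.

open import Data.Bool.Base using (Bool; true; false; not; if_then_else_)
open import Data.Fin.Base using (Fin; zero; suc; toℕ; fromℕ<; _↑ˡ_; _↑ʳ_; splitAt)
import Data.Fin.Properties as Fin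
open import Data.Maybe.Base using (Maybe; just; nothing)
open import Data.Nat.Base as ℕ using (ℕ; zero; suc; _≡ᵇ_; _^_; z≤n; s≤s)
open import Data.Nat.DivMod using (_/_; _%_; m≡m%n+[m/n]*n; m%n<n; m/n*n≤m; m/n≤m; m≥n⇒m/n>0)
import Data.Nat.Properties as ℕ
open import Data.Nat.Tactic.RingSolver using (solve-∀)
open import Data.Product.Base using (∃-syntax; _,_; proj₁)
open import Data.Sum.Base using (_⊎_; inj₁; inj₂; map₁)
open import Data.Vec.Base using (Vec; []; _∷_; lookup)
open import Data.Vec.Functional using (Vector; foldl; _++_; replicate)
open import Data.Vec.Functional.Properties using (lookup-++ˡ; lookup-++ʳ)
open import Defs
open import Function.Base using (_∘_)
open import Relation.Binary.Bundles using (Poset)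
open import Relation.Binary.PropositionalEquality as ≡ using (_≡_; _≢_; _≗_; refl; cong)
import Relation.Binary.Reasoning.PartialOrder as PartialOrderReasoning
open import Relation.Binary.Structures using (IsTotalOrder)
open import Relation.Nullary using (¬_; yes; no; does)
open import Relation.Nullary.Decidable using (¬?; _⊎-dec_; dec-true; dec-false)
open import Relation.Nullary.Negation using (contradiction)
open import Relation.Unary using (Pred; Decidable)
open import Algebra.Properties.CommutativeMonoid.Sum ℕ.+-0-commutativeMonoid
  using () renaming (sum to sumℕ)

-- Sums over bit strings and the fair betting game

module Counting where
  open import Algebra.Properties.CommutativeMonoid.Sum ℕ.*-1-commutativeMonoid
    using () renaming (sum to ∏; sum-cong-≗ to ∏-cong-≗)
  open import Algebra.Properties.CommutativeSemigroup ℕ.+-commutativeSemigroup using (interchange)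
  open import Data.Nat.Base using (_+_; _*_; _≤_)
  open import Data.Nat.Properties
  open ≡ using (refl; sym; trans; cong; cong₂)

  private
    variable
      m b : ℕ

  ∑ᵇ : (Vec Bool m → ℕ) → ℕ
  ∑ᵇ {zero}  F = F []
  ∑ᵇ {suc m} F = ∑ᵇ (F ∘ (false ∷_)) + ∑ᵇ (F ∘ (true ∷_))

  ∑ᵇ-mono : {F G : Vec Bool m → ℕ} → (∀ x → F x ≤ G x) → ∑ᵇ F ≤ ∑ᵇ G
  ∑ᵇ-mono {zero}  F≤G = F≤G []
  ∑ᵇ-mono {suc m} F≤G = +-mono-≤ (∑ᵇ-mono (F≤G ∘ (false ∷_))) (∑ᵇ-mono (F≤G ∘ (true ∷_)))

  ∑ᵇ-cong : {F G : Vec Bool m → ℕ} → (∀ x → F x ≡ G x) → ∑ᵇ F ≡ ∑ᵇ G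
  ∑ᵇ-cong {zero}  F≡G = F≡G []
  ∑ᵇ-cong {suc m} F≡G = cong₂ _+_ (∑ᵇ-cong (F≡G ∘ (false ∷_))) (∑ᵇ-cong (F≡G ∘ (true ∷_)))

  ∑ᵇ-distrib-+ : (F G : Vec Bool m → ℕ) → ∑ᵇ (λ x → F x + G x) ≡ ∑ᵇ F + ∑ᵇ G
  ∑ᵇ-distrib-+ {zero}  F G = refl
  ∑ᵇ-distrib-+ {suc m} F G = trans
    (cong₂ _+_ (∑ᵇ-distrib-+ (F ∘ (false ∷_)) (G ∘ (false ∷_)))
               (∑ᵇ-distrib-+ (F ∘ (true ∷_)) (G ∘ (true ∷_))))
    (interchange (∑ᵇ (F ∘ (false ∷_))) _ _ _)

  ∑ᵇ-distribˡ-* : ∀ k (F : Vec Bool m → ℕ) → ∑ᵇ (λ x → k * F x) ≡ k * ∑ᵇ F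
  ∑ᵇ-distribˡ-* {zero}  k F = refl
  ∑ᵇ-distribˡ-* {suc m} k F = trans
    (cong₂ _+_ (∑ᵇ-distribˡ-* k (F ∘ (false ∷_))) (∑ᵇ-distribˡ-* k (F ∘ (true ∷_))))
    (sym (*-distribˡ-+ k (∑ᵇ (F ∘ (false ∷_))) _))

  ∑ᵇ-const : ∀ m k → ∑ᵇ {m} (λ _ → k) ≡ 2 ^ m * k
  ∑ᵇ-const zero    k = sym (+-identityʳ k)
  ∑ᵇ-const (suc m) k rewrite ∑ᵇ-const m k = double (2 ^ m) k
    where
    double : ∀ p k → p * k + p * k ≡ (p + (p + 0)) * k
    double = solve-∀

  ∑ᵇ-comm : (F : Vec Bool m → Vec Bool b → ℕ) →
           ∑ᵇ (λ x → ∑ᵇ (F x)) ≡ ∑ᵇ (λ s → ∑ᵇ (λ x → F x s))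
  ∑ᵇ-comm {zero}  F = refl
  ∑ᵇ-comm {suc m} F = trans
    (cong₂ _+_ (∑ᵇ-comm (F ∘ (false ∷_))) (∑ᵇ-comm (F ∘ (true ∷_))))
    (sym (∑ᵇ-distrib-+ (λ s → ∑ᵇ (λ x → F (false ∷ x) s)) _))

  -- Serves to replace the message actually sent, which depends on the input, by a sum over all
  -- messages. After that each message can be treated as fixed.
  term≤∑ᵇ : (F : Vec Bool m → ℕ) → ∀ x → F x ≤ ∑ᵇ F
  term≤∑ᵇ F []          = ≤-refl
  term≤∑ᵇ F (false ∷ x) = ≤-trans (term≤∑ᵇ (F ∘ (false ∷_)) x) (m≤m+n _ _)
  term≤∑ᵇ F (true ∷ x)  = ≤-trans (term≤∑ᵇ (F ∘ (true ∷_)) x) (m≤n+m _ _)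

  -- The bits of a uniform string are independent, so the sum factorises coordinate by coordinate
  -- and each coordinate gives a factor 2. In gambling terms: if every single bet is fair, the final
  -- capital has mean 1.
  ∑ᵇ-∏ : (w : Fin m → Bool → ℕ) → (∀ j → w j false + w j true ≡ 2) →
        ∑ᵇ (λ x → ∏ (λ j → w j (lookup x j))) ≡ 2 ^ m
  ∑ᵇ-∏ {zero}  w w≡2 = refl
  ∑ᵇ-∏ {suc m} w w≡2 = begin
    ∑ᵇ (λ x → w zero false * ∏′ x) + ∑ᵇ (λ x → w zero true * ∏′ x)
      ≡⟨ cong₂ _+_ (∑ᵇ-distribˡ-* (w zero false) ∏′) (∑ᵇ-distribˡ-* (w zero true) ∏′) ⟩
    w zero false * ∑ᵇ ∏′ + w zero true * ∑ᵇ ∏′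
      ≡⟨ *-distribʳ-+ (∑ᵇ ∏′) (w zero false) _ ⟨
    (w zero false + w zero true) * ∑ᵇ ∏′
      ≡⟨ cong₂ _*_ (w≡2 zero) (∑ᵇ-∏ (w ∘ suc) (w≡2 ∘ suc)) ⟩
    2 * 2 ^ m ∎
    where
    open ≡.≡-Reasoning
    ∏′ : Vec Bool m → ℕ
    ∏′ x = ∏ (λ j → w (suc j) (lookup x j))

  answered : Maybe Bool → ℕ
  answered (just _) = 1
  answered nothing  = 0

  -- The factor by which the capital changes when all of it is staked on the guess at even odds:
  -- doubled if right, lost if wrong, kept if no guess is made.
  bet : Maybe Bool → Bool → ℕ
  bet (just true)  true  = 2
  bet (just true)  false = 0
  bet (just false) true  = 0
  bet (just false) false = 2
  bet nothing      _     = 1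

  bet-fair : ∀ g → bet g false + bet g true ≡ 2
  bet-fair (just true)  = refl
  bet-fair (just false) = refl
  bet-fair nothing      = refl

  -- A guess that is never wrong cannot lose the stake, so only the factors 1 and 2 remain. This
  -- turns the number of answers into the exponent of the final capital.
  bet-correct : ∀ g {y} → (∀ {β} → g ≡ just β → β ≡ y) → 2 ^ answered g ≡ bet g y
  bet-correct (just true)  {y} sound rewrite sym (sound refl) = refl
  bet-correct (just false) {y} sound rewrite sym (sound refl) = refl
  bet-correct nothing          sound = refl

  2^-sum : (t : Fin m → ℕ) → 2 ^ sumℕ t ≡ ∏ (λ j → 2 ^ t j)
  2^-sum {zero}  t = refl
  2^-sum {suc m} t = trans (^-distribˡ-+-* 2 (t zero) _) (cong (2 ^ t zero *_) (2^-sum (t ∘ suc)))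

  -- The tangent bound 1 + (t − T) ≤ 2 ^ (t − T), rearranged to avoid subtraction.
  2^T*[1+t]≤2^t+2^T*T : ∀ T t → 2 ^ T * (1 + t) ≤ 2 ^ t + 2 ^ T * T
  2^T*[1+t]≤2^t+2^T*T zero    zero    = ≤-refl
  2^T*[1+t]≤2^t+2^T*T zero    (suc t) = begin
    1 * (2 + t)         ≡⟨ split t ⟩
    1 + 1 * (1 + t)     ≤⟨ +-mono-≤ (m^n>0 2 t) (2^T*[1+t]≤2^t+2^T*T zero t) ⟩
    2 ^ t + (2 ^ t + 0) ≡⟨ +-identityʳ (2 ^ suc t) ⟨
    2 ^ suc t + 1 * 0   ∎
    where
    open ≤-Reasoning
    split : ∀ t → 1 * (2 + t) ≡ 1 + 1 * (1 + t)
    split = solve-∀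
  2^T*[1+t]≤2^t+2^T*T (suc T) zero    =
    ≤-trans (*-monoʳ-≤ (2 ^ suc T) (s≤s (z≤n {T}))) (m≤n+m _ 1)
  2^T*[1+t]≤2^t+2^T*T (suc T) (suc t) = begin
    2 ^ suc T * (2 + t)                 ≡⟨ unfold (2 ^ T) t ⟩
    2 * (2 ^ T * (1 + t)) + 2 * 2 ^ T   ≤⟨ +-monoˡ-≤ _ (*-monoʳ-≤ 2 (2^T*[1+t]≤2^t+2^T*T T t)) ⟩
    2 * (2 ^ t + 2 ^ T * T) + 2 * 2 ^ T ≡⟨ fold (2 ^ T) (2 ^ t) T ⟩
    2 ^ suc t + 2 ^ suc T * suc T       ∎
    where
    open ≤-Reasoning
    unfold : ∀ p t → 2 * p * (2 + t) ≡ 2 * (p * (1 + t)) + 2 * p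
    unfold = solve-∀
    fold : ∀ p q T → 2 * (q + p * T) + 2 * p ≡ 2 * q + 2 * p * (1 + T)
    fold = solve-∀

  -- For a fixed message s, betting all money on each answered bit is a fair game, so
  -- 2 ^ (number of answers) has mean at most the number 2 ^ b of messages; the tangent
  -- bound at T = b turns this into a bound on the mean number of answers.
  answers-bound : (M : Vec Bool m → Vec Bool b) (g : Vec Bool b → Fin m → Maybe Bool) →
                  (∀ x j {β} → g (M x) j ≡ just β → β ≡ lookup x j) →
                  ∑ᵇ (λ x → sumℕ (answered ∘ g (M x))) ≤ 2 ^ m * b
  answers-bound {m} {b} M g sound = +-cancelˡ-≤ (2 ^ m) _ _ (*-cancelˡ-≤ (2 ^ b) ⦃ m^n≢0 2 b ⦄ (begin
    2 ^ b * (2 ^ m + ∑ᵇ t)                        ≡⟨ cong (2 ^ b *_) ∑ᵇ1+t ⟨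
    2 ^ b * ∑ᵇ (λ x → 1 + t x)                    ≡⟨ ∑ᵇ-distribˡ-* (2 ^ b) (λ x → 1 + t x) ⟨
    ∑ᵇ (λ x → 2 ^ b * (1 + t x))                  ≤⟨ ∑ᵇ-mono (λ x → 2^T*[1+t]≤2^t+2^T*T b (t x)) ⟩
    ∑ᵇ (λ x → 2 ^ t x + 2 ^ b * b)                ≡⟨ ∑ᵇ-distrib-+ (λ x → 2 ^ t x) _ ⟩
    ∑ᵇ (λ x → 2 ^ t x) + ∑ᵇ {m} (λ _ → 2 ^ b * b) ≤⟨ +-mono-≤ ∑ᵇ2^t (≤-reflexive (∑ᵇ-const m _)) ⟩
    2 ^ b * 2 ^ m + 2 ^ m * (2 ^ b * b)           ≡⟨ collect (2 ^ b) (2 ^ m) b ⟩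
    2 ^ b * (2 ^ m + 2 ^ m * b)                   ∎))
    where
    open ≤-Reasoning
    t : Vec Bool m → ℕ
    t x = sumℕ (answered ∘ g (M x))

    bets : Vec Bool m → Vec Bool b → ℕ
    bets x s = ∏ (λ j → bet (g s j) (lookup x j))

    ∑ᵇ1+t : ∑ᵇ (λ x → 1 + t x) ≡ 2 ^ m + ∑ᵇ t
    ∑ᵇ1+t = trans (∑ᵇ-distrib-+ (λ _ → 1) t) (cong (_+ ∑ᵇ t) (trans (∑ᵇ-const m 1) (*-identityʳ _)))

    ∑ᵇ2^t : ∑ᵇ (λ x → 2 ^ t x) ≤ 2 ^ b * 2 ^ m
    ∑ᵇ2^t = begin
      ∑ᵇ (λ x → 2 ^ t x)              ≡⟨ ∑ᵇ-cong (λ x → trans (2^-sum (answered ∘ g (M x)))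
                                          (∏-cong-≗ (λ j → bet-correct (g (M x) j) (sound x j)))) ⟩
      ∑ᵇ (λ x → bets x (M x))        ≤⟨ ∑ᵇ-mono (λ x → term≤∑ᵇ (bets x) (M x)) ⟩
      ∑ᵇ (λ x → ∑ᵇ (bets x))         ≡⟨ ∑ᵇ-comm bets ⟩
      ∑ᵇ (λ s → ∑ᵇ (λ x → bets x s)) ≡⟨ ∑ᵇ-cong (λ s → ∑ᵇ-∏ (λ j → bet (g s j)) (λ j → bet-fair (g s j))) ⟩
      ∑ᵇ {b} (λ _ → 2 ^ m)           ≡⟨ ∑ᵇ-const b (2 ^ m) ⟩
      2 ^ b * 2 ^ m                  ∎

    collect : ∀ p q b → p * q + q * (p * b) ≡ p * (q + q * b)
    collect = solve-∀

open Counting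

-- Arithmetic, inverses and finite sums in an ordered field

module OrderedFieldProperties {c ℓ₁ ℓ₂} (F : OrderedField c ℓ₁ ℓ₂) where
  open OrderedField F hiding (zero)
  open IsTotalOrder isTotalOrder public
    using (isPartialOrder; antisym; total)
    renaming (refl to ≤-refl; trans to ≤-trans; reflexive to ≤-reflexive)
  open import Algebra.Properties.Semiring.Mult semiring public
    using (×-congʳ; ×-homo-+; ×-homo-1; ×-assocˡ; ×-comm-*; ×-assoc-*)
  open import Algebra.Properties.CommutativeMonoid.Mult +-commutativeMonoid public
    using (×-distrib-+)
  open import Algebra.Properties.Semiring.Sum semiring public
    using (∑-distrib-+; sum-cong-≋; sum-replicate; sum-replicate-zero)
  open import Algebra.Properties.Ring ring public
    using (-‿distribˡ-*; -‿involutive)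
  open import Algebra.Properties.CommutativeSemigroup *-commutativeSemigroup public
    using (xy∙z≈xz∙y)

  poset : Poset c ℓ₁ ℓ₂
  poset = record { isPartialOrder = isPartialOrder }

  open PartialOrderReasoning poset

  +-mono-≤ : ∀ {x y u v} → x ≤ y → u ≤ v → x + u ≤ y + v
  +-mono-≤ {x} {y} {u} {v} x≤y u≤v = begin
    x + u ≤⟨ +-monoʳ-≤ x u≤v ⟩
    x + v ≈⟨ +-comm x v ⟩
    v + x ≤⟨ +-monoʳ-≤ v x≤y ⟩
    v + y ≈⟨ +-comm v y ⟩
    y + v ∎

  +-cancelʳ-≤ : ∀ {x y} z → x + z ≤ y + z → x ≤ y
  +-cancelʳ-≤ {x} {y} z x+z≤y+z = begin
    x           ≈⟨ undo x ⟨
    x + z + - z ≤⟨ +-mono-≤ x+z≤y+z ≤-refl ⟩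
    y + z + - z ≈⟨ undo y ⟩
    y           ∎
    where
    undo : ∀ x → x + z + - z ≈ x
    undo x = trans (+-assoc x z (- z)) (trans (+-congˡ (-‿inverseʳ z)) (+-identityʳ x))

  x≤y⇒0≤y-x : ∀ {x y} → x ≤ y → 0# ≤ y - x
  x≤y⇒0≤y-x {x} {y} x≤y = begin
    0#    ≈⟨ -‿inverseʳ x ⟨
    x - x ≤⟨ +-mono-≤ x≤y ≤-refl ⟩
    y - x ∎

  *-monoˡ-≤ : ∀ {x y z} → 0# ≤ z → x ≤ y → z * x ≤ z * y
  *-monoˡ-≤ {x} {y} {z} 0≤z x≤y = begin
    z * x               ≈⟨ +-identityˡ _ ⟨
    0# + z * x          ≤⟨ +-mono-≤ (*-nonNeg 0≤z (x≤y⇒0≤y-x x≤y)) ≤-refl ⟩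
    z * (y - x) + z * x ≈⟨ distribˡ z (y - x) x ⟨
    z * (y - x + x)     ≈⟨ *-congˡ (trans (+-assoc y (- x) x)
                               (trans (+-congˡ (-‿inverseˡ x)) (+-identityʳ y))) ⟩
    z * y                 ∎

  *-monoʳ-≤ : ∀ {x y z} → 0# ≤ z → x ≤ y → x * z ≤ y * z
  *-monoʳ-≤ {x} {y} {z} 0≤z x≤y = begin
    x * z ≈⟨ *-comm x z ⟩
    z * x ≤⟨ *-monoˡ-≤ 0≤z x≤y ⟩
    z * y ≈⟨ *-comm z y ⟩
    y * z ∎

  0≤1 : 0# ≤ 1#
  0≤1 with total 0# 1#
  ... | inj₁ 0≤1 = 0≤1
  ... | inj₂ 1≤0 = begin
    0#            ≤⟨ *-nonNeg 0≤-1 0≤-1 ⟩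
    - 1# * - 1#   ≈⟨ -‿distribˡ-* 1# (- 1#) ⟨
    - (1# * - 1#) ≈⟨ -‿cong (*-identityˡ (- 1#)) ⟩
    - - 1#        ≈⟨ -‿involutive 1# ⟩
    1#            ∎
    where
    0≤-1 : 0# ≤ - 1#
    0≤-1 = ≤-trans (x≤y⇒0≤y-x 1≤0) (≤-reflexive (+-identityˡ (- 1#)))

  1≰0 : ¬ (1# ≤ 0#)
  1≰0 1≤0 = 0≉1 (antisym 0≤1 1≤0)

  1≤x⇒0≤x : ∀ {x} → 1# ≤ x → 0# ≤ x
  1≤x⇒0≤x = ≤-trans 0≤1

  x≤x+y : ∀ {x y} → 0# ≤ y → x ≤ x + y
  x≤x+y {x} 0≤y = ≤-trans (≤-reflexive (sym (+-identityʳ x))) (+-monoʳ-≤ x 0≤y)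

  y≤x+y : ∀ {x y} → 0# ≤ x → y ≤ x + y
  y≤x+y {x} {y} 0≤x = ≤-trans (x≤x+y 0≤x) (≤-reflexive (+-comm y x))

  ·-mono-≤ : ∀ n {x y} → x ≤ y → n · x ≤ n · y
  ·-mono-≤ zero    x≤y = ≤-refl
  ·-mono-≤ (suc n) x≤y = +-mono-≤ x≤y (·-mono-≤ n x≤y)

  ·-nonNeg : ∀ n {x} → 0# ≤ x → 0# ≤ n · x
  ·-nonNeg zero    0≤x = ≤-refl
  ·-nonNeg (suc n) 0≤x = ≤-trans 0≤x (x≤x+y (·-nonNeg n 0≤x))

  ·-monoˡ-≤ : ∀ {m n x} → 0# ≤ x → m ℕ.≤ n → m · x ≤ n · x
  ·-monoˡ-≤ {n = n} 0≤x ℕ.z≤n   = ·-nonNeg n 0≤x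
  ·-monoˡ-≤ 0≤x (ℕ.s≤s m≤n)     = +-monoʳ-≤ _ (·-monoˡ-≤ 0≤x m≤n)

  1≤n·1 : ∀ {n} → 1 ℕ.≤ n → 1# ≤ n · 1#
  1≤n·1 1≤n = ≤-trans (≤-reflexive (sym (×-homo-1 1#))) (·-monoˡ-≤ 0≤1 1≤n)

  -- An ordered field has characteristic zero: the case of a positive left side against zero would
  -- force `1# ≤ 0#`. This brings the final inequality from the arbitrary field back to the natural
  -- numbers.
  ·1-cancel-≤ : ∀ m n → m · 1# ≤ n · 1# → m ℕ.≤ n
  ·1-cancel-≤ zero    n       _     = ℕ.z≤n
  ·1-cancel-≤ (suc m) zero    1+m≤0 = contradiction
    (≤-trans (x≤x+y (·-nonNeg m 0≤1)) 1+m≤0) 1≰0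
  ·1-cancel-≤ (suc m) (suc n) m≤n   = ℕ.s≤s (·1-cancel-≤ m n (+-cancelʳ-≤ 1# (begin
    m · 1# + 1# ≈⟨ +-comm _ _ ⟩
    1# + m · 1# ≤⟨ m≤n ⟩
    1# + n · 1# ≈⟨ +-comm _ _ ⟩
    n · 1# + 1# ∎)))

  0<x⇒x≉0 : ∀ {x} → 0# < x → x ≉ 0#
  0<x⇒x≉0 (_ , 0≉x) x≈0 = 0≉x (sym x≈0)

  1≤x⇒0<x : ∀ {x} → 1# ≤ x → 0# < x
  1≤x⇒0<x 1≤x = 1≤x⇒0≤x 1≤x , λ 0≈x → 1≰0 (≤-trans 1≤x (≤-reflexive (sym 0≈x)))

  x*x⁻¹≈1 : ∀ {x} → 0# < x → x * x ⁻¹ ≈ 1#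
  x*x⁻¹≈1 0<x = *-inverseʳ (0<x⇒x≉0 0<x)

  ⁻¹-nonNeg : ∀ {x} → 0# < x → 0# ≤ x ⁻¹
  ⁻¹-nonNeg {x} 0<x with total 0# (x ⁻¹)
  ... | inj₁ 0≤x⁻¹ = 0≤x⁻¹
  ... | inj₂ x⁻¹≤0 = contradiction (begin
    1#       ≈⟨ x*x⁻¹≈1 0<x ⟨
    x * x ⁻¹ ≤⟨ *-monoˡ-≤ (proj₁ 0<x) x⁻¹≤0 ⟩
    x * 0#   ≈⟨ zeroʳ x ⟩
    0#       ∎) 1≰0

  x≤y÷z⇒x*z≤y : ∀ {x y z} → 0# < z → x ≤ y ÷ z → x * z ≤ y
  x≤y÷z⇒x*z≤y {x} {y} {z} 0<z x≤y÷z = begin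
    x * z          ≤⟨ *-monoʳ-≤ (proj₁ 0<z) x≤y÷z ⟩
    y * z ⁻¹ * z   ≈⟨ *-assoc y (z ⁻¹) z ⟩
    y * (z ⁻¹ * z) ≈⟨ *-congˡ (trans (*-comm (z ⁻¹) z) (x*x⁻¹≈1 0<z)) ⟩
    y * 1#         ≈⟨ *-identityʳ y ⟩
    y              ∎

  ⁻¹-anti-mono-≤ : ∀ {x y} → 0# < x → 0# < y → x ≤ y → y ⁻¹ ≤ x ⁻¹
  ⁻¹-anti-mono-≤ {x} {y} 0<x 0<y x≤y = begin
    y ⁻¹              ≈⟨ *-identityʳ (y ⁻¹) ⟨
    y ⁻¹ * 1#         ≈⟨ *-congˡ (x*x⁻¹≈1 0<x) ⟨
    y ⁻¹ * (x * x ⁻¹) ≤⟨ *-monoˡ-≤ (⁻¹-nonNeg 0<y) (*-monoʳ-≤ (⁻¹-nonNeg 0<x) x≤y) ⟩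
    y ⁻¹ * (y * x ⁻¹) ≈⟨ *-assoc (y ⁻¹) y (x ⁻¹) ⟨
    y ⁻¹ * y * x ⁻¹   ≈⟨ *-congʳ (trans (*-comm (y ⁻¹) y) (x*x⁻¹≈1 0<y)) ⟩
    1# * x ⁻¹         ≈⟨ *-identityˡ (x ⁻¹) ⟩
    x ⁻¹              ∎

  1⁻¹≈1 : 1# ⁻¹ ≈ 1#
  1⁻¹≈1 = trans (sym (*-identityˡ (1# ⁻¹))) (x*x⁻¹≈1 (1≤x⇒0<x ≤-refl))

  n·x≈n·1*x : ∀ n x → n · x ≈ n · 1# * x
  n·x≈n·1*x n x = trans (×-congʳ n (sym (*-identityˡ x))) (sym (×-assoc-* n 1# x))

  n·0≈0 : ∀ n → n · 0# ≈ 0#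
  n·0≈0 n = trans (n·x≈n·1*x n 0#) (zeroʳ _)

  1≤n·x⇒0<x : ∀ n {x} → 1# ≤ n · x → 0# < x
  1≤n·x⇒0<x n {x} 1≤n·x with total 0# x
  ... | inj₁ 0≤x = 0≤x , λ 0≈x → 1≰0 (≤-trans 1≤n·x (≤-reflexive
                     (trans (×-congʳ n (sym 0≈x)) (n·0≈0 n))))
  ... | inj₂ x≤0 = contradiction (≤-trans 1≤n·x (≤-trans (·-mono-≤ n x≤0) (≤-reflexive (n·0≈0 n)))) 1≰0

  -- With `y` equal to 1 - x, this is y ≥ a/(a+b) with the denominator cleared. It serves twice: for
  -- x = ε, and for x the failure probability.
  complement-bound : ∀ a b {x y} → 1 ℕ.≤ a ℕ.+ b → x ≤ frac b (a ℕ.+ b) → y + x ≈ 1# →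
                     a · 1# ≤ (a ℕ.+ b) · y
  complement-bound a b {x} {y} 1≤a+b x≤b/[a+b] y+x≈1 = +-cancelʳ-≤ (b · 1#) (begin
    a · 1# + b · 1#               ≈⟨ ×-homo-+ 1# a b ⟨
    (a ℕ.+ b) · 1#                ≈⟨ ×-congʳ (a ℕ.+ b) y+x≈1 ⟨
    (a ℕ.+ b) · (y + x)           ≈⟨ ×-distrib-+ y x (a ℕ.+ b) ⟩
    (a ℕ.+ b) · y + (a ℕ.+ b) · x ≤⟨ +-monoʳ-≤ _ (begin
        (a ℕ.+ b) · x      ≈⟨ n·x≈n·1*x (a ℕ.+ b) x ⟩
        (a ℕ.+ b) · 1# * x ≈⟨ *-comm _ x ⟩
        x * (a ℕ.+ b) · 1# ≤⟨ x≤y÷z⇒x*z≤y (1≤x⇒0<x (1≤n·1 1≤a+b)) x≤b/[a+b] ⟩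
        b · 1#             ∎) ⟩
    (a ℕ.+ b) · y + b · 1#        ∎)

  sum-mono-≤ : ∀ {n} {u v : Vector Carrier n} → (∀ i → u i ≤ v i) → sum u ≤ sum v
  sum-mono-≤ {zero}  u≤v = ≤-refl
  sum-mono-≤ {suc n} u≤v = +-mono-≤ (u≤v zero) (sum-mono-≤ (u≤v ∘ suc))

  sum-nonNeg : ∀ {n} {v : Vector Carrier n} → (∀ i → 0# ≤ v i) → 0# ≤ sum v
  sum-nonNeg {n} 0≤v = ≤-trans (≤-reflexive (sym (sum-replicate-zero n))) (sum-mono-≤ 0≤v)

  term≤sum : ∀ {n} {v : Vector Carrier n} → (∀ i → 0# ≤ v i) → ∀ i → v i ≤ sum v
  term≤sum 0≤v zero    = x≤x+y (sum-nonNeg (0≤v ∘ suc))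
  term≤sum 0≤v (suc i) = ≤-trans (term≤sum (0≤v ∘ suc) i) (y≤x+y (0≤v zero))

  sum-split : ∀ m {n} (v : Vector Carrier (m ℕ.+ n)) →
              sum v ≈ sum (v ∘ (_↑ˡ n)) + sum (v ∘ (m ↑ʳ_))
  sum-split zero    v = sym (+-identityˡ _)
  sum-split (suc m) v = trans (+-congˡ (sum-split m (v ∘ suc))) (sym (+-assoc _ _ _))

  sum-· : ∀ {n} k (v : Vector Carrier n) → sum (λ i → k · v i) ≈ k · sum v
  sum-· {zero}  k v = sym (n·0≈0 k)
  sum-· {suc n} k v = trans (+-congˡ (sum-· k (v ∘ suc))) (sym (×-distrib-+ (v zero) _ k))

  ind : Bool → Carrier
  ind b = if b then 1# else 0#

  sum-δ : ∀ {n} (i : Fin n) → sum {n} (λ k → ind (toℕ i ≡ᵇ toℕ k)) ≈ 1#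
  sum-δ {suc n} zero    = trans (+-congˡ (sum-replicate-zero n)) (+-identityʳ 1#)
  sum-δ {suc n} (suc i) = trans (+-identityˡ _) (sum-δ i)

  -- Expectations of counts over the random seed

  module Expectation {s} (weight : Vector Carrier s) (weight-≥0 : ∀ ω → 0# ≤ weight ω)
                     (weight-sum : sum weight ≈ 1#) where

    E : (Fin s → ℕ) → Carrier
    E X = sum λ ω → X ω · weight ω

    E-+ : ∀ X Y → E (λ ω → X ω ℕ.+ Y ω) ≈ E X + E Y
    E-+ X Y = trans (sum-cong-≋ (λ ω → ×-homo-+ (weight ω) (X ω) (Y ω)))
                    (∑-distrib-+ (λ ω → X ω · weight ω) _)

    -- A seed of weight zero contributes nothing to the expectation, so the bound on `X` may fail
    -- there. Such seeds are the ones on which the sampler may output something that is not a node.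
    E-≤-const : ∀ {X} k → (∀ ω → X ω ℕ.≤ k ⊎ weight ω ≈ 0#) → E X ≤ k · 1#
    E-≤-const {X} k X≤k = begin
      E X                      ≤⟨ sum-mono-≤ bound ⟩
      sum (λ ω → k · weight ω) ≈⟨ sum-· k weight ⟩
      k · sum weight           ≈⟨ ×-congʳ k weight-sum ⟩
      k · 1#                   ∎
      where
      bound : ∀ ω → X ω · weight ω ≤ k · weight ω
      bound ω with X≤k ω
      ... | inj₁ Xω≤k = ·-monoˡ-≤ (weight-≥0 ω) Xω≤k
      ... | inj₂ w≈0  = begin
        X ω · weight ω ≈⟨ trans (×-congʳ (X ω) w≈0) (n·0≈0 (X ω)) ⟩
        0#             ≤⟨ ·-nonNeg k (weight-≥0 ω) ⟩
        k · weight ω   ∎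

    -- Lower bounds on expectations are kept in the division-free form `κ ≤ N · E X`. By linearity
    -- of expectation bounds with the same `N` add up, first over the queried positions and then
    -- over the bit strings.
    N·E-+ : ∀ N {X Y κ μ} → κ ≤ N · E X → μ ≤ N · E Y → κ + μ ≤ N · E (λ ω → X ω ℕ.+ Y ω)
    N·E-+ N {X} {Y} {κ} {μ} κ≤ μ≤ = begin
      κ + μ                     ≤⟨ +-mono-≤ κ≤ μ≤ ⟩
      N · E X + N · E Y         ≈⟨ ×-distrib-+ (E X) (E Y) N ⟨
      N · (E X + E Y)           ≈⟨ ×-congʳ N (E-+ X Y) ⟨
      N · E (λ ω → X ω ℕ.+ Y ω) ∎

    sum-≤-N·E : ∀ N {m κ} {X : Fin m → Fin s → ℕ} → (∀ j → κ ≤ N · E (X j)) →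
                m · κ ≤ N · E (λ ω → sumℕ (λ j → X j ω))
    sum-≤-N·E N {zero}  κ≤ = ·-nonNeg N (sum-nonNeg {s} (λ ω → ≤-refl))
    sum-≤-N·E N {suc m} {κ} {X} κ≤ =
      N·E-+ N {X zero} {λ ω → sumℕ (λ j → X (suc j) ω)} (κ≤ zero) (sum-≤-N·E N {X = X ∘ suc} (κ≤ ∘ suc))

    ∑ᵇ-≤-N·E : ∀ N {m κ} {X : Vec Bool m → Fin s → ℕ} → (∀ x → κ ≤ N · E (X x)) →
              (2 ^ m) · κ ≤ N · E (λ ω → ∑ᵇ (λ x → X x ω))
    ∑ᵇ-≤-N·E N {zero}  {κ} κ≤ = ≤-trans (≤-reflexive (×-homo-1 κ)) (κ≤ [])
    ∑ᵇ-≤-N·E N {suc m} {κ} {X} κ≤ = begin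
      (2 ^ suc m) · κ           ≡⟨ ≡.cong (λ k → (2 ^ m ℕ.+ k) · κ) (ℕ.+-identityʳ (2 ^ m)) ⟩
      (2 ^ m ℕ.+ 2 ^ m) · κ     ≈⟨ ×-homo-+ κ (2 ^ m) (2 ^ m) ⟩
      (2 ^ m) · κ + (2 ^ m) · κ ≤⟨ N·E-+ N {λ ω → ∑ᵇ (λ x → X (false ∷ x) ω)} {λ ω → ∑ᵇ (λ x → X (true ∷ x) ω)}
                                       (∑ᵇ-≤-N·E N {X = X ∘ (false ∷_)} (κ≤ ∘ (false ∷_)))
                                       (∑ᵇ-≤-N·E N {X = X ∘ (true ∷_)} (κ≤ ∘ (true ∷_))) ⟩
      N · E (λ ω → ∑ᵇ (λ x → X x ω)) ∎

-- Folds over concatenated streams, and finite case distinction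

private
  variable
    m : ℕ

foldl-cong : ∀ {a b} {A : Set a} {B : Set b} (f : B → A → B) z {n} {xs ys : Vector A n} →
             xs ≗ ys → foldl f z xs ≡ foldl f z ys
foldl-cong f z {zero}  xs≗ys = refl
foldl-cong f z {suc n} {xs} xs≗ys rewrite xs≗ys zero = foldl-cong f _ (xs≗ys ∘ suc)

foldl-split : ∀ {a b} {A : Set a} {B : Set b} (f : B → A → B) z m {n} (xs : Vector A (m ℕ.+ n)) →
              foldl f z xs ≡ foldl f (foldl f z (xs ∘ (_↑ˡ n))) (xs ∘ (m ↑ʳ_))
foldl-split f z zero    xs = refl
foldl-split f z (suc m) xs = foldl-split f _ m (xs ∘ suc)

-- `Q` does not depend on `x`, and there are finitely many bit strings: going through them either
-- meets a proof of `Q` or collects `P` everywhere. This is how an undecided alternative leaves the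
-- quantifier constructively.
all-or : ∀ {p q} {P : Vec Bool m → Set p} {Q : Set q} → (∀ x → P x ⊎ Q) → (∀ x → P x) ⊎ Q
all-or {zero} PQ with PQ []
... | inj₁ p = inj₁ λ { [] → p }
... | inj₂ q = inj₂ q
all-or {suc m} PQ with all-or (PQ ∘ (false ∷_)) | all-or (PQ ∘ (true ∷_))
... | inj₁ p | inj₁ p′ = inj₁ λ { (false ∷ x) → p x ; (true ∷ x) → p′ x }
... | inj₂ q | _       = inj₂ q
... | inj₁ _ | inj₂ q  = inj₂ q

all-or-Fin : ∀ {p q} {P : Fin m → Set p} {Q : Set q} → (∀ j → P j ⊎ Q) → (∀ j → P j) ⊎ Q
all-or-Fin {zero}  PQ = inj₁ λ ()
all-or-Fin {suc m} PQ with PQ zero | all-or-Fin (PQ ∘ suc)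
... | inj₁ p | inj₁ p′ = inj₁ λ { zero → p ; (suc j) → p′ j }
... | inj₂ q | _       = inj₂ q
... | inj₁ _ | inj₂ q  = inj₂ q

-- Items, their similarity, and their coding as numbers

data Item : Set where
  bit   : ℕ → Bool → Item
  query : ℕ → Item

-- Only keys are compared, so every bit string gives the same degrees. One similarity function
-- covers all inputs and all queries at once, so the same algorithm can be run on every stream of
-- the reduction.
similar : Item → Item → Bool
similar (bit k _) (bit k′ _) = k ≡ᵇ k′
similar (bit k _) (query j)  = not (k ≡ᵇ j)
similar (query j) (bit k _)  = not (k ≡ᵇ j)
similar (query _) (query _)  = true

≡ᵇ-refl : ∀ n → (n ≡ᵇ n) ≡ true
≡ᵇ-refl n = dec-true (n ℕ.≟ n) refl

≡ᵇ-sym : ∀ m n → (m ≡ᵇ n) ≡ (n ≡ᵇ m)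
≡ᵇ-sym zero    zero    = refl
≡ᵇ-sym zero    (suc n) = refl
≡ᵇ-sym (suc m) zero    = refl
≡ᵇ-sym (suc m) (suc n) = ≡ᵇ-sym m n

≢⇒≡ᵇ-false : ∀ {m n} → m ≢ n → (m ≡ᵇ n) ≡ false
≢⇒≡ᵇ-false {m} {n} = dec-false (m ℕ.≟ n)

similar-refl : ∀ a → similar a a ≡ true
similar-refl (bit k _) = ≡ᵇ-refl k
similar-refl (query _) = refl

similar-sym : ∀ a b → similar a b ≡ similar b a
similar-sym (bit k _) (bit k′ _) = ≡ᵇ-sym k k′
similar-sym (bit _ _) (query _)  = refl
similar-sym (query _) (bit _ _)  = refl
similar-sym (query _) (query _)  = refl

shift : Item → Item
shift (bit k b) = bit (suc k) b
shift (query j) = query (suc j)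

-- Key `k` owns the three codes 3k, 3k+1 (its two bit items) and 3k+2 (its query item), so `m` keys
-- fit into a universe of size 3m. Decoding is total, hence it gives a similarity on larger
-- universes as well.
decode : ℕ → Item
decode 0                   = bit 0 false
decode 1                   = bit 0 true
decode 2                   = query 0
decode (suc (suc (suc a))) = shift (decode a)

residue : Bool → ℕ
residue false = 0
residue true  = 1

decode-bit : ∀ k b → decode (k ℕ.* 3 ℕ.+ residue b) ≡ bit k b
decode-bit zero    false = refl
decode-bit zero    true  = refl
decode-bit (suc k) b     = cong shift (decode-bit k b)

decode-query : ∀ j → decode (j ℕ.* 3 ℕ.+ 2) ≡ query j
decode-query zero    = refl
decode-query (suc j) = cong shift (decode-query j)

bitOf : Item → Maybe Bool
bitOf (bit _ b) = just b
bitOf (query _) = nothing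

code< : ∀ {m u r} (j : Fin m) → r ℕ.< 3 → m ℕ.* 3 ℕ.≤ u → toℕ j ℕ.* 3 ℕ.+ r ℕ.< u
code< {m} {u} {r} j r<3 3m≤u = begin-strict
  toℕ j ℕ.* 3 ℕ.+ r <⟨ ℕ.+-monoʳ-< (toℕ j ℕ.* 3) r<3 ⟩
  toℕ j ℕ.* 3 ℕ.+ 3 ≡⟨ ℕ.+-comm (toℕ j ℕ.* 3) 3 ⟩
  suc (toℕ j) ℕ.* 3 ≤⟨ ℕ.*-monoˡ-≤ 3 (Fin.toℕ<n j) ⟩
  m ℕ.* 3           ≤⟨ 3m≤u ⟩
  u                 ∎
  where open ℕ.≤-Reasoning

residue<3 : ∀ b → residue b ℕ.< 3
residue<3 false = s≤s z≤n
residue<3 true  = s≤s (s≤s z≤n)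

-- The hard streams and reading a bit from the output

module HardInstance {m u} (3m≤u : m ℕ.* 3 ℕ.≤ u) (l : ℕ) where

  itemOf : Fin u → Item
  itemOf v = decode (toℕ v)

  bitItem : Fin m → Bool → Fin u
  bitItem k b = fromℕ< (code< k (residue<3 b) 3m≤u)

  queryItem : Fin m → Fin u
  queryItem j = fromℕ< (code< j ℕ.≤-refl 3m≤u)

  itemOf-bitItem : ∀ k b → itemOf (bitItem k b) ≡ bit (toℕ k) b
  itemOf-bitItem k b rewrite Fin.toℕ-fromℕ< (code< k (residue<3 b) 3m≤u) = decode-bit (toℕ k) b

  itemOf-queryItem : ∀ j → itemOf (queryItem j) ≡ query (toℕ j)
  itemOf-queryItem j rewrite Fin.toℕ-fromℕ< (code< {r = 2} j ℕ.≤-refl 3m≤u) = decode-query (toℕ j)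

  alice : Vec Bool m → Vector (Fin u) m
  alice x k = bitItem k (lookup x k)

  bob : Fin m → Vector (Fin u) l
  bob j = replicate l (queryItem j)

  stream : Vec Bool m → Fin m → Vector (Fin u) (m ℕ.+ l)
  stream x j = alice x ++ bob j

  itemOf-stream-alice : ∀ x j k → itemOf (stream x j (k ↑ˡ l)) ≡ bit (toℕ k) (lookup x k)
  itemOf-stream-alice x j k =
    ≡.trans (cong itemOf (lookup-++ˡ (alice x) (bob j) k)) (itemOf-bitItem k (lookup x k))

  itemOf-stream-bob : ∀ x j k → itemOf (stream x j (m ↑ʳ k)) ≡ query (toℕ j)
  itemOf-stream-bob x j k =
    ≡.trans (cong itemOf (lookup-++ʳ (alice x) (bob j) k)) (itemOf-queryItem j)

  similar-target-bob : ∀ x j k →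
    similar (itemOf (stream x j (j ↑ˡ l))) (itemOf (stream x j (m ↑ʳ k))) ≡ false
  similar-target-bob x j k
    rewrite itemOf-stream-alice x j j | itemOf-stream-bob x j k | ≡ᵇ-refl (toℕ j) = refl

  similar-alice-alice : ∀ x j i k →
    similar (itemOf (stream x j (i ↑ˡ l))) (itemOf (stream x j (k ↑ˡ l))) ≡ (toℕ i ≡ᵇ toℕ k)
  similar-alice-alice x j i k
    rewrite itemOf-stream-alice x j i | itemOf-stream-alice x j k = refl

  similar-others-bob : ∀ x j i → i ≢ j ↑ˡ l → ∀ k →
    similar (itemOf (stream x j i)) (itemOf (stream x j (m ↑ʳ k))) ≡ true
  -- `_++_` is defined through `splitAt`, so splitting on it makes the item at position `i` compute.
  -- An early item has a key other than `j`; a late one is itself a query item.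
  similar-others-bob x j i i≢j k with splitAt m i in eq
  ... | inj₁ i′ rewrite itemOf-bitItem i′ (lookup x i′) | itemOf-stream-bob x j k
                      | ≢⇒≡ᵇ-false {toℕ i′} {toℕ j} (λ i′≡j → i≢j (≡.trans (≡.sym (Fin.splitAt⁻¹-↑ˡ eq))
                          (cong (_↑ˡ l) (Fin.toℕ-injective i′≡j)))) = refl
  ... | inj₂ _  rewrite itemOf-queryItem j | itemOf-stream-bob x j k = refl

  -- An answer is given only if the sampled position is the queried one; failure and every other
  -- position count as abstention. Hence a low success probability costs answers, not correctness.
  answer : Fin m → Maybe (Node (Fin u) (m ℕ.+ l)) → Maybe Bool
  answer j nothing        = nothing
  answer j (just (i , v)) = if does (i Fin.≟ j ↑ˡ l) then bitOf (itemOf v) else nothing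

  answer-target : ∀ x j → answer j (just (j ↑ˡ l , stream x j (j ↑ˡ l))) ≡ just (lookup x j)
  answer-target x j with (j ↑ˡ l) Fin.≟ (j ↑ˡ l)
  ... | yes _ = cong bitOf (itemOf-stream-alice x j j)
  ... | no ¬p = contradiction refl ¬p

  -- A genuine node at the queried position carries the item that encodes the bit, and any other
  -- position gives no answer.
  answer-sound : ∀ x j i {β} → answer j (just (i , stream x j i)) ≡ just β → β ≡ lookup x j
  answer-sound x j i eq with i Fin.≟ j ↑ˡ l
  ... | yes refl rewrite itemOf-stream-alice x j j with refl ← eq = refl
  answer-sound x j i () | no _

module _ {c ℓ₁ ℓ₂} (F : OrderedField c ℓ₁ ℓ₂) where
  open OrderedField F hiding (zero)
  open OrderedFieldProperties F
  open Streaming F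
  open PartialOrderReasoning poset hiding (start)

  ind-≥0 : ∀ b → 0# ≤ ind b
  ind-≥0 false = ≤-refl
  ind-≥0 true  = 0≤1

  ind-≤1 : ∀ b → ind b ≤ 1#
  ind-≤1 false = 0≤1
  ind-≤1 true  = ≤-refl

  -- Probabilities of events over the seeds

  module OnePassProperties {U : Set} {n b} (M : OnePass U n b) where
    open OnePass M

    Pr-+-¬ : ∀ {ℓ} {P : Pred (Fin seeds) ℓ} (P? : Decidable P) → Pr (λ ω → ¬? (P? ω)) + Pr P? ≈ 1#
    Pr-+-¬ P? = trans (sym (∑-distrib-+ {seeds} _ _)) (trans (sum-cong-≋ split) weight-sum)
      where
      split : ∀ ω → (if not (does (P? ω)) then weight ω else 0#) + (if does (P? ω) then weight ω else 0#) ≈ weight ω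
      split ω with does (P? ω)
      ... | true  = +-identityˡ _
      ... | false = +-identityʳ _

    -- The complement has probability zero and is a sum of nonnegative weights, so each weight in it
    -- is at most zero.
    almost-surely : ∀ {ℓ} {P : Pred (Fin seeds) ℓ} (P? : Decidable P) → Pr P? ≈ 1# →
                    ∀ ω → P ω ⊎ weight ω ≈ 0#
    almost-surely P? Pr≈1 ω with P? ω in eq
    ... | yes p = inj₁ p
    ... | no ¬p = inj₂ (antisym (begin
      weight ω             ≡⟨ cong (λ d → if not (does d) then weight ω else 0#) eq ⟨
      term ω               ≤⟨ term≤sum term≥0 ω ⟩
      Pr (λ ω → ¬? (P? ω)) ≤⟨ +-cancelʳ-≤ 1# (≤-reflexive (trans (+-congˡ (sym Pr≈1))
                                            (trans (Pr-+-¬ P?) (sym (+-identityˡ 1#))))) ⟩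
      0#                               ∎) (weight-≥0 ω))
      where
      term : Fin seeds → Carrier
      term ω = if not (does (P? ω)) then weight ω else 0#
      term≥0 : ∀ ω → 0# ≤ term ω
      term≥0 ω with does (P? ω)
      ... | true  = ≤-refl
      ... | false = weight-≥0 ω

    open Expectation weight weight-≥0 weight-sum

    Pr-nonNeg : ∀ {ℓ} {P : Pred (Fin seeds) ℓ} (P? : Decidable P) → 0# ≤ Pr P?
    Pr-nonNeg P? = sum-nonNeg term≥0
      where
      term≥0 : ∀ ω → 0# ≤ (if does (P? ω) then weight ω else 0#)
      term≥0 ω with does (P? ω)
      ... | true  = weight-≥0 ω
      ... | false = ≤-refl

    Pr-≤-E : ∀ {ℓ} {P : Pred (Fin seeds) ℓ} (P? : Decidable P) {X} →
             (∀ {ω} → P ω → X ω ≡ 1) → Pr P? ≤ E X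
    Pr-≤-E P? {X} P⇒X≡1 = sum-mono-≤ bound
      where
      bound : ∀ ω → (if does (P? ω) then weight ω else 0#) ≤ X ω · weight ω
      bound ω with P? ω
      ... | yes p rewrite P⇒X≡1 p = ≤-reflexive (sym (×-homo-1 (weight ω)))
      ... | no  _ = ·-nonNeg (X ω) (weight-≥0 ω)

  -- Degrees and the normalising sum of the hard instance

  module _ {m u} (3m≤u : m ℕ.* 3 ℕ.≤ u) (l : ℕ) where
    open HardInstance {m} 3m≤u l

    similarity : Similarity (Fin u)
    similarity = record
      { f      = λ v w → ind (similar (itemOf v) (itemOf w))
      ; f-≥0   = λ v w → ind-≥0 (similar (itemOf v) (itemOf w))
      ; f-≤1   = λ v w → ind-≤1 (similar (itemOf v) (itemOf w))
      ; f-sym  = λ v w → reflexive (cong ind (similar-sym (itemOf v) (itemOf w)))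
      ; f-refl = λ v → reflexive (cong ind (similar-refl (itemOf v)))
      }

    module _ (x : Vec Bool m) (j : Fin m) where
      open SimilarityGraph similarity (stream x j)

      degree-target : degree (j ↑ˡ l) ≈ 1#
      degree-target = begin-equality
        degree (j ↑ˡ l)
          ≈⟨ sum-split m _ ⟩
        sum {m} (λ k → ind (similar (itemOf (stream x j (j ↑ˡ l))) (itemOf (stream x j (k ↑ˡ l)))))
          + sum {l} (λ k → ind (similar (itemOf (stream x j (j ↑ˡ l))) (itemOf (stream x j (m ↑ʳ k)))))
          ≈⟨ +-cong (sum-cong-≋ (λ k → reflexive (cong ind (similar-alice-alice x j j k))))
                    (sum-cong-≋ (λ k → reflexive (cong ind (similar-target-bob x j k)))) ⟩
        sum {m} (λ k → ind (toℕ j ≡ᵇ toℕ k)) + sum {l} (λ _ → 0#)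
          ≈⟨ +-cong (sum-δ j) (sum-replicate-zero l) ⟩
        1# + 0#
          ≈⟨ +-identityʳ 1# ⟩
        1# ∎

      degree-others : ∀ i → i ≢ j ↑ˡ l → l · 1# ≤ degree i
      degree-others i i≢j = begin
        l · 1#            ≈⟨ sum-replicate l ⟨
        sum {l} (λ _ → 1#)
          ≈⟨ sum-cong-≋ (λ k → reflexive (cong ind (similar-others-bob x j i i≢j k))) ⟨
        sum {l} (λ k → ind (similar (itemOf (stream x j i)) (itemOf (stream x j (m ↑ʳ k)))))
          ≤⟨ y≤x+y (sum-nonNeg {m} (λ k → ind-≥0 (similar (itemOf (stream x j i)) (itemOf (stream x j (k ↑ˡ l)))))) ⟩
        sum {m} (λ k → ind (similar (itemOf (stream x j i)) (itemOf (stream x j (k ↑ˡ l)))))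
          + sum {l} (λ k → ind (similar (itemOf (stream x j i)) (itemOf (stream x j (m ↑ʳ k)))))
          ≈⟨ sum-split m _ ⟨
        degree i ∎

      module _ (m≤l : m ℕ.≤ l) (1≤l : 1 ℕ.≤ l) where

        0<l : 0# < l · 1#
        0<l = 1≤x⇒0<x (1≤n·1 1≤l)

        1≤degree : ∀ i → 1# ≤ degree i
        1≤degree i with i Fin.≟ j ↑ˡ l
        ... | yes ≡.refl = ≤-reflexive (sym degree-target)
        ... | no  i≢j    = ≤-trans (1≤n·1 1≤l) (degree-others i i≢j)

        degree⁻¹-target : degree (j ↑ˡ l) ⁻¹ ≈ 1#
        degree⁻¹-target = trans (⁻¹-cong degree-target) 1⁻¹≈1

        0<DI : 0# < DI
        0<DI = 1≤x⇒0<x (begin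
          1#                 ≈⟨ degree⁻¹-target ⟨
          degree (j ↑ˡ l) ⁻¹ ≤⟨ term≤sum (λ i → ⁻¹-nonNeg (1≤x⇒0<x (1≤degree i))) (j ↑ˡ l) ⟩
          DI                 ∎)

        -- The target contributes 1. A further allowance of 1/l for each of the m + l ≤ 2l nodes
        -- covers all the others and adds at most 2.
        DI≤3 : DI ≤ 3 · 1#
        DI≤3 = begin
          DI
            ≤⟨ sum-mono-≤ bound ⟩
          sum {m ℕ.+ l} (λ i → δ i + L ⁻¹)
            ≈⟨ ∑-distrib-+ δ _ ⟩
          sum δ + sum {m ℕ.+ l} (λ _ → L ⁻¹)
            ≈⟨ +-cong (sum-δ (j ↑ˡ l)) (sum-replicate (m ℕ.+ l)) ⟩
          1# + (m ℕ.+ l) · (L ⁻¹)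
            ≤⟨ +-monoʳ-≤ 1# (·-monoˡ-≤ (⁻¹-nonNeg 0<l) m+l≤2*l) ⟩
          1# + (2 ℕ.* l) · (L ⁻¹)
            ≈⟨ +-congˡ (trans (sym (×-assocˡ (L ⁻¹) 2 l)) (×-congʳ 2 (trans (n·x≈n·1*x l (L ⁻¹)) (x*x⁻¹≈1 0<l)))) ⟩
          3 · 1# ∎
          where
          L : Carrier
          L = l · 1#
          δ : Fin (m ℕ.+ l) → Carrier
          δ i = ind (toℕ (j ↑ˡ l) ≡ᵇ toℕ i)
          m+l≤2*l : m ℕ.+ l ℕ.≤ 2 ℕ.* l
          m+l≤2*l = ℕ.+-mono-≤ m≤l (ℕ.≤-reflexive (≡.sym (ℕ.+-identityʳ l)))
          bound : ∀ i → degree i ⁻¹ ≤ δ i + L ⁻¹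
          bound i with i Fin.≟ j ↑ˡ l
          ... | yes ≡.refl = begin
            degree (j ↑ˡ l) ⁻¹ ≈⟨ degree⁻¹-target ⟩
            1#                 ≡⟨ cong ind (≡ᵇ-refl (toℕ (j ↑ˡ l))) ⟨
            δ (j ↑ˡ l)         ≤⟨ x≤x+y (⁻¹-nonNeg 0<l) ⟩
            δ (j ↑ˡ l) + L ⁻¹  ∎
          ... | no i≢j = begin
            degree i ⁻¹ ≤⟨ ⁻¹-anti-mono-≤ 0<l (1≤x⇒0<x (1≤degree i)) (degree-others i i≢j) ⟩
            L ⁻¹        ≤⟨ y≤x+y (ind-≥0 (toℕ (j ↑ˡ l) ≡ᵇ toℕ i)) ⟩
            δ i + L ⁻¹  ∎

    -- The one-way protocol for INDEX and the memory bound

    module _ (m≤l : m ℕ.≤ l) (1≤l : 1 ℕ.≤ l) {b} (M : OnePass (Fin u) (m ℕ.+ l) b)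
             {ε} a c d (ε<a/[1+a] : ε < frac a (1 ℕ.+ a)) (1≤c : 1 ℕ.≤ c)
             (sampler : ∀ σ → Sampling.IsSample similarity M σ ε (frac d (c ℕ.+ d))) where
      open OnePass M
      open OnePassProperties M
      open Expectation weight weight-≥0 weight-sum

      feed : ∀ {k} → Fin seeds → Vec Bool b → Vector (Node (Fin u) (m ℕ.+ l)) k → Vec Bool b
      feed ω s vs = foldl (λ s v → step ω v s) s vs

      -- The memory after the first `m` items is Alice's message in a protocol with a public seed.
      -- It is fixed before the query `j` is known, so a single message must serve all `m` queries,
      -- and `reply` sees `x` only through it.
      message : Fin seeds → Vec Bool m → Vec Bool b
      message ω x = feed ω (start ω) (λ k → k ↑ˡ l , alice x k)

      reply : Fin seeds → Fin m → Vec Bool b → Maybe (Node (Fin u) (m ℕ.+ l))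
      reply ω j s = output ω (feed ω s (λ k → m ↑ʳ k , bob j k))

      run-stream : ∀ ω x j → run (stream x j) ω ≡ reply ω j (message ω x)
      run-stream ω x j = cong (output ω) (≡.trans
        (foldl-split (λ s v → step ω v s) (start ω) m (λ i → i , stream x j i))
        (≡.trans
          (foldl-cong _ _ (λ k → cong (m ↑ʳ k ,_) (lookup-++ʳ (alice x) (bob j) k)))
          (cong (λ s → feed ω s (λ k → m ↑ʳ k , bob j k))
            (foldl-cong _ _ (λ k → cong (k ↑ˡ l ,_) (lookup-++ˡ (alice x) (bob j) k))))))

      guess : Fin seeds → Vec Bool b → Fin m → Maybe Bool
      guess ω s j = answer j (reply ω j s)

      guess-message : ∀ ω x j → guess ω (message ω x) j ≡ answer j (run (stream x j) ω)
      guess-message ω x j = cong (answer j) (≡.sym (run-stream ω x j))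

      -- weight ω ≈ 0# is not decidable; it is extracted from the finitely many streams.
      guesses-sound : ∀ ω → (∀ x j {β} → guess ω (message ω x) j ≡ just β → β ≡ lookup x j)
                            ⊎ weight ω ≈ 0#
      guesses-sound ω = all-or λ x → all-or-Fin λ j → sound x j
        where
        sound : ∀ x j → (∀ {β} → guess ω (message ω x) j ≡ just β → β ≡ lookup x j) ⊎ weight ω ≈ 0#
        sound x j with almost-surely (λ ω → fails? ω ⊎-dec outputsNode? ω) node ω
          where
          open Sampling similarity M (stream x j)
          open IsSample (sampler (stream x j))
        ... | inj₂ w≈0 = inj₂ w≈0
        ... | inj₁ (inj₁ fails) = inj₁ λ eq → contradiction
          (≡.trans (≡.sym eq) (≡.trans (guess-message ω x j) (cong (answer j) fails))) λ ()
        ... | inj₁ (inj₂ (i , outputs)) = inj₁ λ eq → answer-sound x j i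
          (≡.trans (≡.sym (≡.trans (guess-message ω x j) (cong (answer j) outputs))) eq)

      answers : Fin seeds → Vec Bool m → Fin m → ℕ
      answers ω x j = answered (guess ω (message ω x) j)

      -- h ≥ (1 − ε) Pr(no failure) / DI ≥ 1/(1+a) · c/(c+d) · 1/3 = c/N for the
      -- probability h of outputting the target node.
      N : ℕ
      N = (1 ℕ.+ a) ℕ.* (c ℕ.+ d) ℕ.* 3

      target-probability : ∀ x j → c · 1# ≤ N · E (λ ω → answers ω x j)
      target-probability x j = begin
        c · 1#                        ≈⟨ *-identityˡ (c · 1#) ⟨
        1# * c · 1#                   ≤⟨ *-monoʳ-≤ (·-nonNeg c 0≤1) 1≤[1+a]r ⟩
        (1 ℕ.+ a) · r * c · 1#        ≤⟨ *-monoˡ-≤ (1≤x⇒0≤x 1≤[1+a]r) c≤[c+d]q ⟩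
        (1 ℕ.+ a) · r * (c ℕ.+ d) · q ≈⟨ trans (×-assoc-* (1 ℕ.+ a) r _)
                                               (×-congʳ (1 ℕ.+ a) (×-comm-* (c ℕ.+ d) r q)) ⟩
        (1 ℕ.+ a) · (c ℕ.+ d) · (r * q) ≤⟨ ·-mono-≤ (1 ℕ.+ a) (·-mono-≤ (c ℕ.+ d) rq≤3h) ⟩
        (1 ℕ.+ a) · (c ℕ.+ d) · 3 · h   ≈⟨ trans (×-assocˡ (3 · h) (1 ℕ.+ a) (c ℕ.+ d))
                                               (×-assocˡ h ((1 ℕ.+ a) ℕ.* (c ℕ.+ d)) 3) ⟩
        N · h                       ≤⟨ ·-mono-≤ N (Pr-≤-E (outputs? (j ↑ˡ l)) hit) ⟩
        N · E (λ ω → answers ω x j) ∎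
        where
        open Sampling similarity M (stream x j)
        open SimilarityGraph similarity (stream x j)
        open IsSample (sampler (stream x j))
        r q h : Carrier
        r = 1# - ε
        q = Pr (λ ω → ¬? (fails? ω))
        h = Pr (outputs? (j ↑ˡ l))
        1≤[1+a]r : 1# ≤ (1 ℕ.+ a) · r
        1≤[1+a]r = ≤-trans (≤-reflexive (sym (×-homo-1 1#)))
          (complement-bound 1 a (s≤s z≤n) (proj₁ ε<a/[1+a])
            (trans (+-assoc 1# (- ε) ε) (trans (+-congˡ (-‿inverseˡ ε)) (+-identityʳ 1#))))
        c≤[c+d]q : c · 1# ≤ (c ℕ.+ d) · q
        c≤[c+d]q = complement-bound c d (ℕ.≤-trans 1≤c (ℕ.m≤m+n c d)) failure (Pr-+-¬ fails?)
        0<q : 0# < q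
        0<q = 1≤n·x⇒0<x (c ℕ.+ d) (≤-trans (1≤n·1 1≤c) c≤[c+d]q)
        hit : ∀ {ω} → run (stream x j) ω ≡ just (j ↑ˡ l , stream x j (j ↑ˡ l)) → answers ω x j ≡ 1
        hit {ω} outputs = cong answered (≡.trans (guess-message ω x j)
          (≡.trans (cong (answer j) outputs) (answer-target x j)))
        -- The guarantee `lower` concerns the probability conditioned on no failure, `h ÷ q`. The
        -- failure bound makes `q` positive, so the conditioning can be multiplied away.
        r÷DI*q≤h : r ÷ DI * q ≤ h
        r÷DI*q≤h = x≤y÷z⇒x*z≤y 0<q (begin
          r ÷ DI                        ≈⟨ *-congˡ (trans (*-congʳ (degree⁻¹-target x j m≤l 1≤l)) (*-identityˡ _)) ⟨
          r * (degree (j ↑ˡ l) ⁻¹ ÷ DI) ≤⟨ lower (j ↑ˡ l) ⟩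
          h ÷ q                         ∎)
        rq≤3h : r * q ≤ 3 · h
        rq≤3h = begin
          r * q                ≈⟨ *-identityʳ (r * q) ⟨
          r * q * 1#           ≈⟨ *-congˡ (trans (*-comm (DI ⁻¹) DI) (x*x⁻¹≈1 (0<DI x j m≤l 1≤l))) ⟨
          r * q * (DI ⁻¹ * DI) ≈⟨ *-assoc (r * q) (DI ⁻¹) DI ⟨
          r * q * DI ⁻¹ * DI   ≈⟨ *-congʳ (xy∙z≈xz∙y r q (DI ⁻¹)) ⟩
          r ÷ DI * q * DI      ≤⟨ *-monoʳ-≤ (proj₁ (0<DI x j m≤l 1≤l)) r÷DI*q≤h ⟩
          h * DI               ≤⟨ *-monoˡ-≤ 0≤h (DI≤3 x j m≤l 1≤l) ⟩
          h * 3 · 1#           ≈⟨ trans (×-comm-* 3 h 1#) (×-congʳ 3 (*-identityʳ h)) ⟩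
          3 · h                ∎
          where
          0≤h : 0# ≤ h
          0≤h = Pr-nonNeg (outputs? (j ↑ˡ l))

      -- Double counting of the answers over all strings `x` and queries `j`. Each pair is answered
      -- with probability at least c/N, so the expected total is at least 2^m · m · c/N. For every
      -- seed of nonzero weight the total is at most 2^m · b.
      memory-bound : c ℕ.* m ℕ.≤ N ℕ.* b
      memory-bound = ℕ.*-cancelˡ-≤ (2 ^ m) ⦃ ℕ.m^n≢0 2 m ⦄ (·1-cancel-≤ _ _ (begin
        (2 ^ m ℕ.* (c ℕ.* m)) · 1#
          ≡⟨ cong (λ k → (2 ^ m ℕ.* k) · 1#) (ℕ.*-comm c m) ⟩
        (2 ^ m ℕ.* (m ℕ.* c)) · 1#
          ≈⟨ trans (×-congʳ (2 ^ m) (×-assocˡ 1# m c)) (×-assocˡ 1# (2 ^ m) (m ℕ.* c)) ⟨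
        (2 ^ m) · m · c · 1#
          ≤⟨ ∑ᵇ-≤-N·E N (λ x → sum-≤-N·E N (target-probability x)) ⟩
        N · E count
          ≤⟨ ·-mono-≤ N (E-≤-const (2 ^ m ℕ.* b) count≤) ⟩
        N · (2 ^ m ℕ.* b) · 1#
          ≈⟨ ×-assocˡ 1# N (2 ^ m ℕ.* b) ⟩
        (N ℕ.* (2 ^ m ℕ.* b)) · 1#
          ≡⟨ cong (_· 1#) (swap N (2 ^ m) b) ⟩
        (2 ^ m ℕ.* (N ℕ.* b)) · 1#
          ∎))
        where
        swap : ∀ a b c → a ℕ.* (b ℕ.* c) ≡ b ℕ.* (a ℕ.* c)
        swap = solve-∀
        count : Fin seeds → ℕ
        count ω = ∑ᵇ (λ x → sumℕ (answers ω x))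
        count≤ : ∀ ω → count ω ℕ.≤ 2 ^ m ℕ.* b ⊎ weight ω ≈ 0#
        count≤ ω = map₁ (answers-bound (message ω) (guess ω)) (guesses-sound ω)

  -- Instantiating the parameters and the linear bound

  sampler-bound : ∀ {n s u l ε} (A : OnePassAlgorithm n s) → ε < frac 9 10 →
                  IsLDISampler ε (frac 49 100) A → 3 ℕ.≤ n → n ℕ.≤ u → n ≡ n / 3 ℕ.+ l →
                  51 ℕ.* (n / 3) ℕ.≤ 3000 ℕ.* s u
  sampler-bound {n} {s} {u} {l} A ε<9/10 sampler 3≤n n≤u n≡m+l = apply (n / 3) n≡m+l
    (ℕ.≤-trans (m/n*n≤m n 3) n≤u) m≤l (ℕ.≤-trans (m≥n⇒m/n>0 3≤n) m≤l)
    where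
    m≤l : n / 3 ℕ.≤ l
    m≤l = ℕ.+-cancelˡ-≤ (n / 3) _ _
      (ℕ.≤-trans (ℕ.+-monoʳ-≤ (n / 3) (ℕ.m≤m+n (n / 3) (n / 3 ℕ.+ 0)))
      (ℕ.≤-trans (ℕ.≤-reflexive (ℕ.*-comm 3 (n / 3)))
      (ℕ.≤-trans (m/n*n≤m n 3) (ℕ.≤-reflexive n≡m+l))))
    -- With m a variable, the equation n ≡ m + l can be matched against refl.
    apply : ∀ m → n ≡ m ℕ.+ l → m ℕ.* 3 ℕ.≤ u → m ℕ.≤ l → 1 ℕ.≤ l → 51 ℕ.* m ℕ.≤ 3000 ℕ.* s u
    apply m ≡.refl 3m≤u m≤l 1≤l =
      -- With `a` = 9 the bound on ε is 9/10, and with `c` = 51, `d` = 49 the failure bound is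
      -- 49/100. Then `N` is 10 · 100 · 3 = 3000.
      memory-bound {m} 3m≤u l m≤l 1≤l (A u (similarity {m} 3m≤u l)) 9 51 49 ε<9/10 (s≤s z≤n)
        (sampler u (similarity {m} 3m≤u l))

-- Weakening 51 to 50 gives n/3 ≤ 60b for the integer quotient, hence the summand 180b. The
-- remainder of `n` modulo 3 is at most 2, and this is at most 2b because n ≥ 3 makes the quotient,
-- and with it `b`, positive.
linear-bound : ∀ {n b} → 3 ℕ.≤ n → 51 ℕ.* (n / 3) ℕ.≤ 3000 ℕ.* b → n ℕ.≤ 182 ℕ.* b
linear-bound {n} {b} 3≤n 51m≤3000b = begin
  n                          ≡⟨ m≡m%n+[m/n]*n n 3 ⟩
  n % 3 ℕ.+ n / 3 ℕ.* 3      ≤⟨ ℕ.+-mono-≤ (ℕ.≤-pred (m%n<n n 3)) (ℕ.*-monoˡ-≤ 3 m≤60b) ⟩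
  2 ℕ.+ 60 ℕ.* b ℕ.* 3       ≤⟨ ℕ.+-monoˡ-≤ _ (ℕ.*-monoʳ-≤ 2 1≤b) ⟩
  2 ℕ.* b ℕ.+ 60 ℕ.* b ℕ.* 3 ≡⟨ collect b ⟩
  182 ℕ.* b                  ∎
  where
  open ℕ.≤-Reasoning
  m≤60b : n / 3 ℕ.≤ 60 ℕ.* b
  m≤60b = ℕ.*-cancelˡ-≤ 50 (begin
    50 ℕ.* (n / 3)    ≤⟨ ℕ.*-monoˡ-≤ (n / 3) (ℕ.n≤1+n 50) ⟩
    51 ℕ.* (n / 3)    ≤⟨ 51m≤3000b ⟩
    3000 ℕ.* b        ≡⟨ ℕ.*-assoc 50 60 b ⟩
    50 ℕ.* (60 ℕ.* b) ∎)
  1≤b : 1 ℕ.≤ b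
  1≤b = ℕ.*-cancelˡ-< 60 0 b (ℕ.≤-trans (m≥n⇒m/n>0 3≤n) m≤60b)
  collect : ∀ b → 2 ℕ.* b ℕ.+ 60 ℕ.* b ℕ.* 3 ≡ 182 ℕ.* b
  collect = solve-∀

open import Data.Nat.Base using (_≤_; _*_)

theorem18 : ∀ {c ℓ₁ ℓ₂} →
    ∃[ K ] ∃[ N ]
    ((F : OrderedField c ℓ₁ ℓ₂) →
    let module F = OrderedField F
        open Streaming F
    in
    (ε : F.Carrier) → F.0# F.< ε → ε F.< F.frac 9 10 →
    (n : ℕ) → N ≤ n →
    (s : ℕ → ℕ) (A : OnePassAlgorithm n s) →
    IsLDISampler ε (F.frac 49 100) A →
    (u : ℕ) → n ≤ u → n ≤ K * s u)
-- The threshold 3 ensures that at least one bit is encoded. The number of query items is l = n -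
-- ⌊n/3⌋.
theorem18 = 182 , 3 , λ F ε _ ε<9/10 n 3≤n s A sampler u n≤u →
  linear-bound {b = s u} 3≤n
    (sampler-bound F A ε<9/10 sampler 3≤n n≤u (≡.sym (ℕ.m+[n∸m]≡n (m/n≤m n 3))))
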